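{- Let $G$ be an almost linear minimal group, with a definable strict partial order $<$ such that incomparability $\sim$ is an equivalence relation on $G$ and $G/{\sim}$, with the order induced by $<$, has order type $\omega$. Then, after modifying the order $<$ on a finite set, the map $v:G\to G/{\sim}$, $g\mapsto g/{\sim}$, endows $G$ with the structure of a valued abelian group, where $G/{\sim}$ is ordered by $g/{\sim}>g'/{\sim}$ if $g<g'$, and this order on $G/{\sim}$ is of order type $\omega^*$. In particular, $G$ as an almost linear group and $G$ as a valued group are interdefinable (with parameters).
   Context: An infinite first-order structure $M$ is minimal if every subset of $M$ definable with parameters is finite or co-finite. A minimal group is a minimal structure which is a group, possibly with additional first-order structure; minimal groups are abelian and written additively. The generic type of $M$ is the unique non-algebraic type $p\in S_1(M)$; $\bar M\succ M$ is a monster model. For a strict partial order $<$, put $x\sim y$ iff $\neg(x<y\vee y<x)$ (incomparability). A strict partial order $<$ on $M$, definable with parameters and with infinite chains, is almost linear if $\sim$ is an equivalence relation on the set $p(\bar M)$ of realizations of $p$; $M$ is almost linear if such an order exists. In an almost linear minimal group a definable order $<$ can always be chosen so that $\sim$ is an equivalence relation on $G$ and $G/{\sim}$ has order type $\omega$; such a choice is fixed. "Modifying $<$ on a finite set" means replacing $<$ by a definable strict partial order which agrees with $<$ on the complement of some finite set $F\subseteq G$ (relations between elements of $F$ and arbitrary elements may change); after the modification, $\sim$ denotes incomparability for the new order (which is again an equivalence relation). A valued abelian group is an abelian group $G$ with a surjective map $v:G\to\Gamma$, where $\Gamma$ is a linearly ordered set with maximum $\infty$, such that $v(x)=\infty$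 iff $x=0$, and $v(x-y)\ge\min\{v(x),v(y)\}$. $\omega^*$ is the reverse order of $\omega$. "Interdefinable" means that the order $<$ is definable with parameters in the valued group $(G,+,v)$, and the valuation (i.e. the relation $v(x)\le v(y)$) is definable with parameters in $(G,+,<)$. -}

module Defs where

open import Level using (Level; suc)
open import Algebra.Structures using (IsAbelianGroup)
import Algebra.Construct.NaturalChoice.Min as Min
open import Data.Empty.Polymorphic using (⊥)
open import Data.Fin.Base using (Fin)
open import Data.List.Base using (List)
open import Data.List.Membership.Propositional using (_∈_; _∉_)
open import Data.List.Relation.Unary.All using (All)
open import Data.Nat.Base using (ℕ)
import Data.Nat.Base as ℕ
open import Data.Product.Base using (Σ; ∃; _×_; proj₁)
open import Data.Sum.Base using (_⊎_; [_,_])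
open import Data.Vec.Base using (Vec; []; _∷_; lookup)
open import Function.Base using (id; flip; _on_)
open import Function.Bundles using (_⇔_)
open import Function.Definitions using (Surjective)
open import Relation.Binary.Bundles using (TotalOrder)
open import Relation.Binary.Core using (Rel)
open import Relation.Binary.Definitions using (Maximum)
open import Relation.Binary.Morphism.Structures using (IsOrderIsomorphism)
open import Relation.Binary.PropositionalEquality.Core using (_≡_; _≢_)
open import Relation.Binary.Structures using (IsEquivalence; IsStrictPartialOrder; IsTotalOrder)
open import Relation.Nullary.Negation.Core using (¬_)
open import Relation.Unary using (Pred; U; ∁)

------------------------------------------------------------------------
-- First-order logic with equality

record Signature (ℓ : Level) : Set (suc ℓ) where
  field
    Function : ℕ → Set ℓ
    Relation : ℕ → Set ℓ

open Signature public

-- P is a set of parameters (names of elements); n is the number of free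
-- variables, which are de Bruijn indices.

data Term {ℓ} (L : Signature ℓ) (P : Set ℓ) (n : ℕ) : Set ℓ where
  par : P → Term L P n
  var : Fin n → Term L P n
  app : ∀ {k} → Function L k → Vec (Term L P n) k → Term L P n

infix  7 _≐_
infixr 6 _∧̇_
infixr 5 _∨̇_
infixr 4 _⇒̇_

data Formula {ℓ} (L : Signature ℓ) (P : Set ℓ) (n : ℕ) : Set ℓ where
  _≐_           : Term L P n → Term L P n → Formula L P n
  rel           : ∀ {k} → Relation L k → Vec (Term L P n) k → Formula L P n
  ⊥̇             : Formula L P n
  _∧̇_ _∨̇_ _⇒̇_ : Formula L P n → Formula L P n → Formula L P n
  ∀̇_ ∃̇_         : Formula L P (ℕ.suc n) → Formula L P n

record Interpretation {ℓ} (L : Signature ℓ) (A : Set ℓ) : Set (suc ℓ) where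
  field
    ⟦_⟧ᶠ : ∀ {k} → Function L k → Vec A k → A
    ⟦_⟧ʳ : ∀ {k} → Relation L k → Vec A k → Set ℓ

record Structure {ℓ} (L : Signature ℓ) : Set (suc ℓ) where
  field
    Carrier        : Set ℓ
    interpretation : Interpretation L Carrier

  open Interpretation interpretation public

module _ {ℓ} {L : Signature ℓ} (M : Structure L) where
  open Structure M

  module _ {P : Set ℓ} (ρ : P → Carrier) where

    mutual
      eval : ∀ {n} → Term L P n → Vec Carrier n → Carrier
      eval (par p)    xs = ρ p
      eval (var i)    xs = lookup xs i
      eval (app f ts) xs = ⟦ f ⟧ᶠ (evals ts xs)

      evals : ∀ {n k} → Vec (Term L P n) k → Vec Carrier n → Vec Carrier k
      evals []       xs = []
      evals (t ∷ ts) xs = eval t xs ∷ evals ts xs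

    Sat : ∀ {n} → Formula L P n → Vec Carrier n → Set ℓ
    Sat (s ≐ t)    xs = eval s xs ≡ eval t xs
    Sat (rel R ts) xs = ⟦ R ⟧ʳ (evals ts xs)
    Sat ⊥̇          xs = ⊥
    Sat (φ ∧̇ ψ)    xs = Sat φ xs × Sat ψ xs
    Sat (φ ∨̇ ψ)    xs = Sat φ xs ⊎ Sat ψ xs
    Sat (φ ⇒̇ ψ)    xs = Sat φ xs → Sat ψ xs
    Sat (∀̇ φ)      xs = ∀ x → Sat φ (x ∷ xs)
    Sat (∃̇ φ)      xs = ∃ λ x → Sat φ (x ∷ xs)

    Set₁[_] : Formula L P 1 → Pred Carrier ℓ
    Set₁[ φ ] x = Sat φ (x ∷ [])

    Rel₂[_] : Formula L P 2 → Rel Carrier ℓ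
    Rel₂[ φ ] x y = Sat φ (x ∷ y ∷ [])

  Definable₂ : Rel Carrier ℓ → Set ℓ
  Definable₂ R = ∃ λ (φ : Formula L Carrier 2) → ∀ x y → Rel₂[_] id φ x y ⇔ R x y

------------------------------------------------------------------------
-- Minimality

Finite : ∀ {a p} {A : Set a} → Pred A p → Set _
Finite {A = A} P = ∃ λ (xs : List A) → ∀ x → P x → x ∈ xs

Cofinite : ∀ {a p} {A : Set a} → Pred A p → Set _
Cofinite P = Finite (∁ P)

module _ {ℓ} {L : Signature ℓ} (M : Structure L) where
  open Structure M

  record IsMinimal : Set ℓ where
    field
      infinite : ¬ Finite {A = Carrier} U
      minimal  : ∀ (φ : Formula L Carrier 1) → Finite (Set₁[_] M id φ) ⊎ Cofinite (Set₁[_] M id φ)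

  record ElementaryExtension : Set (suc ℓ) where
    field
      N          : Structure L
      ι          : Carrier → Structure.Carrier N
      elementary : ∀ (φ : Formula L Carrier 0) → Sat M id φ [] ⇔ Sat N ι φ []

  -- Saturation over all parameter sets of cardinality at most
  -- |M| + |L| + ℵ₀, the cardinality of the set of L-formulas over M.  Such a
  -- parameter set is given as a family b, and a partial type over it as a set
  -- of formulas in the corresponding names.

  record IsMonster (E : ElementaryExtension) : Set (suc ℓ) where
    open ElementaryExtension E
    field
      saturated :
        (b : Formula L Carrier 1 → Structure.Carrier N)
        (Φ : Pred (Formula L (Formula L Carrier 1) 1) ℓ) →
        (∀ φs → All Φ φs → ∃ λ x → All (λ φ → Set₁[_] N b φ x) φs) →
        ∃ λ x → ∀ φ → Φ φ → Set₁[_] N b φ x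

  -- The type of a over M is non-algebraic, i.e. a realizes the generic type.
  -- A formula over M is algebraic iff it has finitely many solutions in M, as
  -- these are then all its solutions in every elementary extension.

  Generic : (E : ElementaryExtension) → Pred (Structure.Carrier (ElementaryExtension.N E)) ℓ
  Generic E a = ∀ (φ : Formula L Carrier 1) → Set₁[_] N ι φ a → ¬ Finite (Set₁[_] M id φ)
    where open ElementaryExtension E

Incomparable : ∀ {a ℓ} {A : Set a} → Rel A ℓ → Rel A ℓ
Incomparable _<_ x y = ¬ (x < y ⊎ y < x)

HasInfiniteChain : ∀ {ℓ} {A : Set ℓ} → Rel A ℓ → Set (suc ℓ)
HasInfiniteChain {ℓ} {A} _<_ =
  ∃ λ (C : Pred A ℓ) → ¬ Finite C × (∀ x y → C x → C y → x ≢ y → x < y ⊎ y < x)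

record AlmostLinear {ℓ} {L : Signature ℓ} (M : Structure L) : Set (suc ℓ) where
  open Structure M
  field
    order                : Formula L Carrier 2
    isStrictPartialOrder : IsStrictPartialOrder _≡_ (Rel₂[_] M id order)
    infiniteChain        : HasInfiniteChain (Rel₂[_] M id order)
    isEquivalence        :
      ∀ (E : ElementaryExtension M) → IsMonster M E →
      let open ElementaryExtension E in
      IsEquivalence {A = Σ (Structure.Carrier N) (Generic M E)}
        (Incomparable (Rel₂[_] N ι order) on proj₁)

------------------------------------------------------------------------
-- Abelian groups with additional structure

data GroupFunction {ℓ} : ℕ → Set ℓ where
  plus  : GroupFunction 2
  zero  : GroupFunction 0
  minus : GroupFunction 1

data BinaryRelation {ℓ} : ℕ → Set ℓ where
  R : BinaryRelation 2

binary : ∀ {ℓ} → Signature ℓ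
binary = record { Function = λ _ → ⊥ ; Relation = BinaryRelation }

group+ : ∀ {ℓ} → Signature ℓ → Signature ℓ
group+ {ℓ} L = record
  { Function = λ k → GroupFunction {ℓ} k ⊎ Function L k
  ; Relation = Relation L
  }

record ExpandedGroup {ℓ} (L : Signature ℓ) : Set (suc ℓ) where
  infixl 6 _+_
  infix  8 -_
  field
    Carrier        : Set ℓ
    _+_            : Carrier → Carrier → Carrier
    0#             : Carrier
    -_             : Carrier → Carrier
    isAbelianGroup : IsAbelianGroup _≡_ _+_ 0# -_
    additional     : Interpretation L Carrier

  groupFunction : ∀ {k} → GroupFunction {ℓ} k → Vec Carrier k → Carrier
  groupFunction plus  (x ∷ y ∷ []) = x + y
  groupFunction zero  []           = 0#
  groupFunction minus (x ∷ [])     = - x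

  expandBy : ∀ {L′ : Signature ℓ} → Interpretation L′ Carrier → Structure (group+ L′)
  expandBy I = record
    { Carrier        = Carrier
    ; interpretation = record
      { ⟦_⟧ᶠ = [ groupFunction , Interpretation.⟦_⟧ᶠ I ]
      ; ⟦_⟧ʳ = Interpretation.⟦_⟧ʳ I
      }
    }

  structure : Structure (group+ L)
  structure = expandBy additional

  -- The structure (G, +, S); the additional structure of G is forgotten.

  groupWith : Rel Carrier ℓ → Structure (group+ binary)
  groupWith S = expandBy record
    { ⟦_⟧ᶠ = λ ()
    ; ⟦_⟧ʳ = λ { R (x ∷ y ∷ []) → S x y }
    }

  Interdefinable : Rel Carrier ℓ → Rel Carrier ℓ → Set ℓ
  Interdefinable S T = Definable₂ (groupWith T) S × Definable₂ (groupWith S) T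

-- v makes the group underlying G a valued group with value set Γ.

record IsValuation {ℓ c ℓ₁ ℓ₂} {L : Signature ℓ} (G : ExpandedGroup L)
                   (Γ : TotalOrder c ℓ₁ ℓ₂)
                   (v : ExpandedGroup.Carrier G → TotalOrder.Carrier Γ) : Set (ℓ Level.⊔ c Level.⊔ ℓ₁ Level.⊔ ℓ₂) where
  open ExpandedGroup G using (_+_; 0#; -_)
  open TotalOrder Γ using (_≈_; _≤_) renaming (Carrier to Value)
  open Min Γ using (_⊓_)
  field
    surjective  : Surjective _≡_ _≈_ v
    ∞           : Value
    maximum     : Maximum _≤_ ∞
    v≈∞⇔≡0      : ∀ x → v x ≈ ∞ ⇔ x ≡ 0#
    ultrametric : ∀ x y → (v x ⊓ v y) ≤ v (x + (- y))

------------------------------------------------------------------------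
-- The quotient by incomparability.  It is represented by G itself with ∼ as
-- equality, so that the quotient map g ↦ g/∼ is the identity on elements.

module _ {ℓ} {A : Set ℓ} (_<_ : Rel A ℓ) where

  -- g/∼ is below g′/∼ in the value order iff g′ < g.

  ValueLess : Rel A ℓ
  ValueLess = flip _<_

  ValueLeq : Rel A ℓ
  ValueLeq x y = ValueLess x y ⊎ Incomparable _<_ x y

  HasQuotientOfTypeω : Set ℓ
  HasQuotientOfTypeω =
    ∃ λ (f : A → ℕ) → IsOrderIsomorphism (Incomparable _<_) _≡_ _<_ ℕ._<_ f

  HasValueOrderOfTypeω* : Set ℓ
  HasValueOrderOfTypeω* =
    ∃ λ (f : A → ℕ) → IsOrderIsomorphism (Incomparable _<_) _≡_ ValueLess (flip ℕ._<_) f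

  quotientOrder : IsTotalOrder (Incomparable _<_) ValueLeq → TotalOrder ℓ ℓ ℓ
  quotientOrder isTotalOrder = record { isTotalOrder = isTotalOrder }

  quotientMap : (isTotalOrder : IsTotalOrder (Incomparable _<_) ValueLeq) →
                A → TotalOrder.Carrier (quotientOrder isTotalOrder)
  quotientMap _ g = g

AgreeOffFiniteSet : ∀ {a ℓ} {A : Set a} → Rel A ℓ → Rel A ℓ → Set _
AgreeOffFiniteSet {A = A} _<_ _<′_ =
  ∃ λ (F : List A) → ∀ x y → x ∉ F → y ∉ F → (x <′ y) ⇔ (x < y)

{-# OPTIONS --safe #-}

-- Let f x be the position of x/∼ in ω.  Minimality makes the initial segments
-- of < finite, and every definable set that contains elements of arbitrarily
-- large f is cofinite.  For each a, f z ≤ f (z + a) holds for almost all z: if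
-- not, a long enough initial segment would be mapped by the injection
-- z ↦ z + a into itself but not onto, which is absurd for a finite set.  So the
-- subgroups
--   S n = { a ∣ f z ≤ f (z + a) and f z ≤ f (z - a) whenever n ≤ f z }
-- exhaust G.  For every K there are elements x, y with f ≥ K such that the
-- predecessors of x for < precede x in the filtration S, and those of y for
-- the filtration precede y for <.  Both properties are definable, hence hold
-- of almost all elements, so that far enough < and the filtration S have the
-- same initial segments, which are therefore subgroups.  It remains to collapse
-- a large initial segment to the two classes of 0 and of its other elements.

module Submission where

open import Defs
open import Level using (Level; Lift; lift; lower)
open import Algebra.Bundles using (AbelianGroup)
import Algebra.Properties.AbelianGroup as AbelianGroupProperties
import Algebra.Construct.NaturalChoice.Min as Min
open import Axiom.DoubleNegationElimination using (em⇒dne)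
open import Axiom.ExcludedMiddle using (ExcludedMiddle)
open import Data.Fin.Base using (Fin; zero; suc; toℕ)
open import Data.Fin.Patterns using (0F; 1F; 2F)
open import Data.Fin.Properties using (pigeonhole)
open import Data.List.Base using (List; []; _∷_; length; cartesianProduct)
open import Data.List.Membership.Propositional using (_∈_; _∉_)
open import Data.List.Membership.Propositional.Properties using (∈-cartesianProduct⁺)
open import Data.List.Relation.Unary.Any using (here; there; index)
open import Data.List.Relation.Unary.Any.Properties using (lookup-index)
open import Data.Nat.Base using (ℕ; zero; suc; _≤_; _<_; _∸_; _⊔_; z≤n; s≤s; z<s; s<s)
import Data.Nat.Base as ℕ
open import Data.Nat.GeneralisedArithmetic using (fold)
open import Data.Nat.Induction using (<-rec)
open import Data.Nat.Properties
open import Data.Product.Base using (Σ; ∃; _×_; _,_; proj₁; proj₂; map₂)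
open import Data.Product.Function.NonDependent.Propositional using (_×-⇔_)
open import Data.Sum.Base using (_⊎_; inj₁; inj₂; [_,_]′)
open import Data.Sum.Function.Propositional using (_⊎-⇔_)
open import Data.Vec.Base using (Vec; []; _∷_; lookup)
open import Function.Base using (_∘_; id)
open import Function.Bundles using (_⇔_; mk⇔; Equivalence)
open import Function.Construct.Composition using (_⇔-∘_)
open import Function.Construct.Identity using (⇔-id)
open import Function.Construct.Symmetry using (⇔-sym)
open import Function.Definitions using (Injective)
open import Function.Related.TypeIsomorphisms using (→-cong-⇔)
open import Relation.Binary.Core using (Rel)
open import Relation.Binary.Definitions using (tri<; tri≈; tri>)
open import Relation.Binary.Morphism.Structures using (IsOrderIsomorphism)
open import Relation.Binary.PropositionalEquality
  using (_≡_; _≢_; refl; sym; trans; cong; cong₂; subst)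
  renaming (isEquivalence to ≡-isEquivalence)
open import Relation.Binary.Structures using (IsEquivalence; IsStrictPartialOrder; IsTotalOrder)
open import Relation.Nullary using (¬_; yes; no; contradiction)
open import Relation.Unary using (Pred)

open Equivalence using (to; from)

private variable
  ℓ p q : Level
  k m n : ℕ

-- Substitution

module _ {L : Signature ℓ} {P : Set ℓ} where

  mutual
    substitute : (Fin m → Term L P n) → Term L P m → Term L P n
    substitute σ (par a)    = par a
    substitute σ (var i)    = σ i
    substitute σ (app f ts) = app f (substitutes σ ts)

    substitutes : (Fin m → Term L P n) → Vec (Term L P m) k → Vec (Term L P n) k
    substitutes σ []       = []
    substitutes σ (t ∷ ts) = substitute σ t ∷ substitutes σ ts

  lift-subst : (Fin m → Term L P n) → Fin (suc m) → Term L P (suc n)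
  lift-subst σ zero    = var zero
  lift-subst σ (suc i) = substitute (var ∘ suc) (σ i)

  substituteᶠ : (Fin m → Term L P n) → Formula L P m → Formula L P n
  substituteᶠ σ (s ≐ t)    = substitute σ s ≐ substitute σ t
  substituteᶠ σ (rel Q ts) = rel Q (substitutes σ ts)
  substituteᶠ σ ⊥̇          = ⊥̇
  substituteᶠ σ (φ ∧̇ ψ)    = substituteᶠ σ φ ∧̇ substituteᶠ σ ψ
  substituteᶠ σ (φ ∨̇ ψ)    = substituteᶠ σ φ ∨̇ substituteᶠ σ ψ
  substituteᶠ σ (φ ⇒̇ ψ)    = substituteᶠ σ φ ⇒̇ substituteᶠ σ ψ
  substituteᶠ σ (∀̇ φ)      = ∀̇ substituteᶠ (lift-subst σ) φ
  substituteᶠ σ (∃̇ φ)      = ∃̇ substituteᶠ (lift-subst σ) φ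

∀-cong-⇔ : {A : Set ℓ} {B : A → Set p} {C : A → Set q} →
           (∀ x → B x ⇔ C x) → (∀ x → B x) ⇔ (∀ x → C x)
∀-cong-⇔ h = mk⇔ (λ b x → to (h x) (b x)) (λ c x → from (h x) (c x))

∃-cong-⇔ : {A : Set ℓ} {B : A → Set p} {C : A → Set q} →
           (∀ x → B x ⇔ C x) → ∃ B ⇔ ∃ C
∃-cong-⇔ h = mk⇔ (map₂ (to (h _))) (map₂ (from (h _)))

module _ {L : Signature ℓ} (M : Structure L) where
  open Structure M

  module _ {P : Set ℓ} (ρ : P → Carrier) where

    -- A record, unlike the bare pointwise equation, lets `σ`, `xs` and `ys` be inferred from the
    -- proof.
    record Realises (σ : Fin m → Term L P n) (xs : Vec Carrier n) (ys : Vec Carrier m) : Set ℓ where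
      constructor realises
      field eval≡lookup : ∀ i → eval M ρ (σ i) xs ≡ lookup ys i

    open Realises

    mutual
      eval-substitute : ∀ {σ : Fin m → Term L P n} {xs ys} → Realises σ xs ys →
                        ∀ t → eval M ρ (substitute σ t) xs ≡ eval M ρ t ys
      eval-substitute r (par a)    = refl
      eval-substitute r (var i)    = eval≡lookup r i
      eval-substitute r (app f ts) = cong ⟦ f ⟧ᶠ (evals-substitutes r ts)

      evals-substitutes : ∀ {σ : Fin m → Term L P n} {xs ys} → Realises σ xs ys →
                          ∀ (ts : Vec (Term L P m) k) →
                          evals M ρ (substitutes σ ts) xs ≡ evals M ρ ts ys
      evals-substitutes r []       = refl
      evals-substitutes r (t ∷ ts) =
        cong₂ _∷_ (eval-substitute r t) (evals-substitutes r ts)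

    lift-realises : ∀ {σ : Fin m → Term L P n} {xs ys} → Realises σ xs ys →
                    ∀ x → Realises (lift-subst σ) (x ∷ xs) (x ∷ ys)
    lift-realises {σ = σ} (realises r) x = realises λ where
      zero    → refl
      -- A term weakened by `var ∘ suc` does not see `x`, so it evaluates as before.
      (suc i) → trans (eval-substitute (realises λ _ → refl) (σ i)) (r i)

    Sat-substitute : ∀ {σ : Fin m → Term L P n} {xs ys} → Realises σ xs ys →
                     ∀ φ → Sat M ρ (substituteᶠ σ φ) xs ⇔ Sat M ρ φ ys
    Sat-substitute r (s ≐ t)
      rewrite eval-substitute r s | eval-substitute r t = ⇔-id _
    Sat-substitute r (rel Q ts) rewrite evals-substitutes r ts = ⇔-id _
    Sat-substitute r ⊥̇       = ⇔-id _
    Sat-substitute r (φ ∧̇ ψ) = Sat-substitute r φ ×-⇔ Sat-substitute r ψ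
    Sat-substitute r (φ ∨̇ ψ) = Sat-substitute r φ ⊎-⇔ Sat-substitute r ψ
    Sat-substitute r (φ ⇒̇ ψ) = →-cong-⇔ (Sat-substitute r φ) (Sat-substitute r ψ)
    Sat-substitute r (∀̇ φ)   = ∀-cong-⇔ λ x → Sat-substitute (lift-realises r x) φ
    Sat-substitute r (∃̇ φ)   = ∃-cong-⇔ λ x → Sat-substitute (lift-realises r x) φ

    lookup-evals : ∀ (ts : Vec (Term L P n) m) xs → Realises (lookup ts) xs (evals M ρ ts xs)
    lookup-evals []       xs = realises λ ()
    lookup-evals (t ∷ ts) xs = realises λ where
      zero    → refl
      (suc i) → eval≡lookup (lookup-evals ts xs) i

-- Definable sets of tuples

  Definable : Pred (Vec Carrier n) p → Set _
  Definable {n} X = ∃ λ (φ : Formula L Carrier n) → ∀ xs → Sat M id φ xs ⇔ X xs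

  private variable
    X : Pred (Vec Carrier n) p
    Y : Pred (Vec Carrier n) q

  definable-resp-⇔ : (∀ xs → X xs ⇔ Y xs) → Definable X → Definable Y
  definable-resp-⇔ h (φ , φ⇔) = φ , λ xs → h xs ⇔-∘ φ⇔ xs

  definable-≐ : ∀ (s t : Term L Carrier n) →
                Definable (λ xs → eval M id s xs ≡ eval M id t xs)
  definable-≐ s t = s ≐ t , λ _ → ⇔-id _

  definable-× : Definable X → Definable Y → Definable (λ xs → X xs × Y xs)
  definable-× (φ , φ⇔) (ψ , ψ⇔) = φ ∧̇ ψ , λ xs → φ⇔ xs ×-⇔ ψ⇔ xs

  definable-⊎ : Definable X → Definable Y → Definable (λ xs → X xs ⊎ Y xs)
  definable-⊎ (φ , φ⇔) (ψ , ψ⇔) = φ ∨̇ ψ , λ xs → φ⇔ xs ⊎-⇔ ψ⇔ xs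

  definable-→ : Definable X → Definable Y → Definable (λ xs → X xs → Y xs)
  definable-→ (φ , φ⇔) (ψ , ψ⇔) = (φ ⇒̇ ψ) , λ xs → →-cong-⇔ (φ⇔ xs) (ψ⇔ xs)

  definable-¬ : Definable X → Definable (λ xs → ¬ X xs)
  definable-¬ (φ , φ⇔) =
    -- `⊥̇` is satisfied by the polymorphic empty type, whereas negation uses the ordinary one.
    (φ ⇒̇ ⊥̇) , λ xs → →-cong-⇔ (φ⇔ xs) (mk⇔ (λ ()) (λ ()))

  definable-∀ : Definable X → Definable (λ xs → ∀ x → X (x ∷ xs))
  definable-∀ (φ , φ⇔) = ∀̇ φ , λ xs → ∀-cong-⇔ λ x → φ⇔ (x ∷ xs)

  definable-∃ : Definable X → Definable (λ xs → ∃ λ x → X (x ∷ xs))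
  definable-∃ (φ , φ⇔) = ∃̇ φ , λ xs → ∃-cong-⇔ λ x → φ⇔ (x ∷ xs)

  -- The single tool for permuting variables, inserting parameters and applying group operations
  -- inside a definable relation.
  definable-∘ : Definable X → ∀ (ts : Vec (Term L Carrier n) m) →
                Definable (λ xs → X (evals M id ts xs))
  definable-∘ (φ , φ⇔) ts =
    substituteᶠ (lookup ts) φ ,
    λ xs → φ⇔ _ ⇔-∘ Sat-substitute id (lookup-evals id ts xs) φ

  module _ {Q : Rel Carrier ℓ} where

    definable₂⇒definable : Definable₂ M Q → Definable (λ xs → Q (lookup xs 0F) (lookup xs 1F))
    definable₂⇒definable (φ , φ⇔) = φ , λ { (x ∷ y ∷ []) → φ⇔ x y }

    definable⇒definable₂ : Definable (λ xs → Q (lookup xs 0F) (lookup xs 1F)) → Definable₂ M Q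
    definable⇒definable₂ (φ , φ⇔) = φ , λ x y → φ⇔ (x ∷ y ∷ [])

  -- Induction on the list of exceptional pairs: each step corrects the relation at one pair, naming
  -- its two elements as parameters.
  definable₂-modulo-finite : ExcludedMiddle ℓ → ∀ {Q S : Rel Carrier ℓ} (F : List (Carrier × Carrier)) →
                             (∀ x y → (x , y) ∉ F → Q x y ⇔ S x y) →
                             Definable₂ M Q → Definable₂ M S
  definable₂-modulo-finite em [] h (φ , φ⇔) =
    φ , λ x y → h x y (λ ()) ⇔-∘ φ⇔ x y
  definable₂-modulo-finite em {Q} {S} ((a , b) ∷ F) h Q-def =
    definable₂-modulo-finite em F Q′⇔S (definable⇒definable₂ Q′-def)
    where
    At : Rel Carrier ℓ
    At x y = x ≡ a × y ≡ b

    Q′ : Rel Carrier ℓ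
    Q′ x y = At x y × S a b ⊎ ¬ At x y × Q x y

    at-def : Definable (λ xs → At (lookup xs 0F) (lookup xs 1F))
    at-def = definable-× (definable-≐ (var 0F) (par a)) (definable-≐ (var 1F) (par b))

    off-def : Definable (λ xs → ¬ At (lookup xs 0F) (lookup xs 1F) × Q (lookup xs 0F) (lookup xs 1F))
    off-def = definable-× (definable-¬ at-def) (definable₂⇒definable Q-def)

    Q′-def : Definable (λ xs → Q′ (lookup xs 0F) (lookup xs 1F))
    -- `S a b` need not be expressible by a formula, but it is a fixed truth value: its two cases
    -- give two different formulas.
    Q′-def with em {S a b}
    ... | yes s = definable-resp-⇔
      (λ _ → mk⇔ (_, s) proj₁ ⊎-⇔ ⇔-id _) (definable-⊎ at-def off-def)
    ... | no ¬s = definable-resp-⇔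
      (λ _ → mk⇔ inj₂ [ (λ (_ , s) → contradiction s ¬s) , id ]′) off-def

    Q′⇔S : ∀ x y → (x , y) ∉ F → Q′ x y ⇔ S x y
    Q′⇔S x y xy∉F with em {At x y}
    ... | yes (refl , refl) =
      mk⇔ [ proj₂ , (λ (¬at , _) → contradiction (refl , refl) ¬at) ]′
          (λ s → inj₁ ((refl , refl) , s))
    ... | no ¬at = h x y xy∉ ⇔-∘
      mk⇔ [ (λ (at , _) → contradiction at ¬at) , proj₂ ]′ (λ r → inj₂ (¬at , r))
      where
      xy∉ : (x , y) ∉ (a , b) ∷ F
      xy∉ (here refl) = ¬at (refl , refl)
      xy∉ (there ∈F)  = xy∉F ∈F

-- Ranks

bounded-on : {A : Set ℓ} (g : A → ℕ) (xs : List A) → ∃ λ n → ∀ {x} → x ∈ xs → g x < n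
bounded-on g []       = 0 , λ ()
bounded-on g (x ∷ xs) with n , g<n ← bounded-on g xs =
  suc (g x) ⊔ n , λ { (here refl) → m≤m⊔n (suc (g x)) n
                    ; (there y∈)  → <-≤-trans (g<n y∈) (m≤n⊔m (suc (g x)) n) }

minimal-element : ExcludedMiddle ℓ → {A : Set ℓ} (g : A → ℕ) (Q : Pred A ℓ) → ∃ Q →
                  ∃ λ x → Q x × (∀ y → g y < g x → ¬ Q y)
minimal-element em g Q (a , qa) = <-rec
  (λ n → ∀ x → g x ≡ n → Q x → ∃ λ x → Q x × (∀ y → g y < g x → ¬ Q y))
  (λ { _ rec x refl qx → step x (λ y lt → rec lt y refl) qx }) (g a) a refl qa
  where
  step : ∀ x → (∀ y → g y < g x → Q y → ∃ λ x → Q x × (∀ y → g y < g x → ¬ Q y)) →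
         Q x → ∃ λ x → Q x × (∀ y → g y < g x → ¬ Q y)
  step x rec qx with em {∃ λ y → g y < g x × Q y}
  ... | yes (y , lt , qy) = rec y lt qy
  ... | no none           = x , qx , λ y lt qy → none (y , lt , qy)

-- By the pigeonhole principle two of the first `length xs + 1` iterates occupy the same place in
-- `xs`; injectivity strips the common iterations until one of the two is `z` itself.
recurrent : {A : Set ℓ} {s : A → A} → Injective _≡_ _≡_ s → ∀ z (xs : List A) →
            (∀ k → fold z s k ∈ xs) → ∃ λ k → fold z s (suc k) ≡ z
recurrent {s = s} s-inj z xs orbit∈
  with i , j , i<j , eq ← pigeonhole (n<1+n (length xs)) (λ i → index (orbit∈ (toℕ i)))
  = cancel (toℕ i) (toℕ j) i<j (trans (lookup-index (orbit∈ (toℕ i)))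
      (trans (cong (Data.List.Base.lookup xs) eq) (sym (lookup-index (orbit∈ (toℕ j))))))
  where
  cancel : ∀ i j → i < j → fold z s i ≡ fold z s j → ∃ λ k → fold z s (suc k) ≡ z
  cancel zero    (suc k) _         eq = k , sym eq
  cancel (suc i) (suc j) (s<s i<j) eq = cancel i j i<j (s-inj eq)

-- Orders defined by a surjective rank function

module RankOrder {A : Set ℓ} (g : A → ℕ) (g-surj : ∀ n → ∃ λ x → g x ≡ n) where

  infix 4 _≺_

  -- The lift brings the comparison to the level in which formulas take their truth values.
  _≺_ : Rel A ℓ
  x ≺ y = Lift ℓ (g x < g y)

  ≺-isStrictPartialOrder : IsStrictPartialOrder _≡_ _≺_
  ≺-isStrictPartialOrder = record
    { isEquivalence = ≡-isEquivalence
    ; irrefl        = λ { refl (lift lt) → <-irrefl refl lt }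
    ; trans         = λ (lift x<y) (lift y<z) → lift (<-trans x<y y<z)
    ; <-resp-≈      = (λ { refl → id }) , (λ { refl → id })
    }

  incomparable⇔ : ∀ {x y} → Incomparable _≺_ x y ⇔ g x ≡ g y
  incomparable⇔ {x} {y} = mk⇔ equal
    λ eq → [ <-irrefl eq ∘ lower , <-irrefl (sym eq) ∘ lower ]′
    where
    equal : Incomparable _≺_ x y → g x ≡ g y
    equal x∼y with <-cmp (g x) (g y)
    ... | tri< lt _ _ = contradiction (inj₁ (lift lt)) x∼y
    ... | tri≈ _ eq _ = eq
    ... | tri> _ _ gt = contradiction (inj₂ (lift gt)) x∼y

  valueLeq⇔ : ∀ {x y} → ValueLeq _≺_ x y ⇔ g y ≤ g x
  valueLeq⇔ {x} {y} = mk⇔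
    [ <⇒≤ ∘ lower , ≤-reflexive ∘ sym ∘ to incomparable⇔ ]′
    λ le → [ inj₁ ∘ lift , inj₂ ∘ from incomparable⇔ ∘ sym ]′ (m≤n⇒m<n∨m≡n le)

  -- Together with `¬valueLeq⇔≺` this makes the strict order and the value order negations of each
  -- other, hence each definable from the other.
  ≮⇔valueLeq : ∀ x y → (¬ x ≺ y) ⇔ ValueLeq _≺_ x y
  ≮⇔valueLeq x y = mk⇔ (λ x⊀y → from valueLeq⇔ (≮⇒≥ (x⊀y ∘ lift)))
                       (λ le → ≤⇒≯ (to valueLeq⇔ le) ∘ lower)

  ¬valueLeq⇔≺ : ∀ x y → (¬ ValueLeq _≺_ x y) ⇔ x ≺ y
  ¬valueLeq⇔≺ x y = mk⇔ (λ ≰ → lift (≰⇒> (≰ ∘ from valueLeq⇔)))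
                        (λ (lift lt) le → <⇒≱ lt (to valueLeq⇔ le))

  ∼-isEquivalence : IsEquivalence (Incomparable _≺_)
  ∼-isEquivalence = record
    { refl  = from incomparable⇔ refl
    ; sym   = λ x∼y → from incomparable⇔ (sym (to incomparable⇔ x∼y))
    ; trans = λ x∼y y∼z → from incomparable⇔ (trans (to incomparable⇔ x∼y) (to incomparable⇔ y∼z))
    }

  valueLeq-isTotalOrder : IsTotalOrder (Incomparable _≺_) (ValueLeq _≺_)
  valueLeq-isTotalOrder = record
    { isPartialOrder = record
      { isPreorder = record
        { isEquivalence = ∼-isEquivalence
        ; reflexive     = inj₂
        ; trans         = λ x≤y y≤z →
            from valueLeq⇔ (≤-trans (to valueLeq⇔ y≤z) (to valueLeq⇔ x≤y))
        }
      ; antisym = λ x≤y y≤x →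
          from incomparable⇔ (≤-antisym (to valueLeq⇔ y≤x) (to valueLeq⇔ x≤y))
      }
    ; total = λ x y → [ inj₂ ∘ from valueLeq⇔ , inj₁ ∘ from valueLeq⇔ ]′ (≤-total (g x) (g y))
    }

  hasValueOrderOfTypeω* : HasValueOrderOfTypeω* _≺_
  hasValueOrderOfTypeω* = g , record
    { isOrderMonomorphism = record
      { isOrderHomomorphism = record { cong = to incomparable⇔ ; mono = lower }
      ; injective           = from incomparable⇔
      ; cancel              = lift
      }
    ; surjective = λ n → let x , gx≡n = g-surj n in
        x , λ x∼y → trans (to incomparable⇔ x∼y) gx≡n
    }

-- Initial segments of an almost linear order on a minimal group

module _ {ℓ} (em : ExcludedMiddle ℓ) {L : Signature ℓ} (G : ExpandedGroup L) where
  open ExpandedGroup G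

  private
    abelianGroup : AbelianGroup ℓ ℓ
    abelianGroup = record { isAbelianGroup = isAbelianGroup }

  open AbelianGroup abelianGroup using (assoc; comm; inverseʳ; _-_)
  open AbelianGroupProperties abelianGroup
    using (∙-cancelʳ; ⁻¹-anti-homo‿-; //-rightDividesˡ)

  module InitialSegments
    (G-minimal : IsMinimal structure)
    (f : Carrier → ℕ) (f-surj : ∀ n → ∃ λ x → f x ≡ n)
    (≤-def : Definable structure {n = 2} (λ xs → f (lookup xs 0F) ≤ f (lookup xs 1F)))
    where

    open IsMinimal G-minimal

    infixl 6 _+̇_
    infix  8 -̇_

    _+̇_ : (s t : Term (group+ L) Carrier n) → Term (group+ L) Carrier n
    s +̇ t = app (inj₁ plus) (s ∷ t ∷ [])

    -̇_ : Term (group+ L) Carrier n → Term (group+ L) Carrier n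
    -̇ t = app (inj₁ minus) (t ∷ [])

    ≤̇-def : ∀ (s t : Term (group+ L) Carrier n) →
            Definable structure (λ xs → f (eval structure id s xs) ≤ f (eval structure id t xs))
    ≤̇-def s t = definable-∘ structure ≤-def (s ∷ t ∷ [])

    -- The segment is definable with a parameter of rank `n`. It cannot be cofinite, because its
    -- complement has elements of arbitrarily large rank while a finite list has bounded rank.
    initialSegment-finite : ∀ n → Finite (λ x → f x ≤ n)
    initialSegment-finite n
      with c , refl ← f-surj n
      with φ , φ⇔ ← ≤̇-def {n = 1} (var 0F) (par c)
      with minimal φ
    ... | inj₁ (xs , ∈xs) = xs , λ x le → ∈xs x (from (φ⇔ (x ∷ [])) le)
    ... | inj₂ (xs , ∈xs)
      with b , <b ← bounded-on f xs
      -- Rank above `f c` puts `z` outside the segment, and rank at least `b` keeps it off the list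
      -- of the complement.
      with z , fz≡ ← f-surj (suc (f c) ⊔ b) =
      contradiction (≤-trans (m≤n⊔m (suc (f c)) b) (≤-reflexive (sym fz≡)))
        (<⇒≱ (<b (∈xs z λ sat → <⇒≱ (≤-trans (m≤m⊔n _ b) (≤-reflexive (sym fz≡)))
                                      (to (φ⇔ (z ∷ [])) sat))))

    bounded-on-initialSegment : ∀ (h : Carrier → ℕ) n → ∃ λ m → ∀ x → f x ≤ n → h x < m
    bounded-on-initialSegment h n =
      let xs , ∈xs = initialSegment-finite n
          m , <m   = bounded-on h xs
      in m , λ x fx≤n → <m (∈xs x fx≤n)

    -- Unbounded rank rules out the finite case of minimality. In the cofinite case any bound on the
    -- ranks of the exceptions will do.
    eventually : {X : Pred (Vec Carrier 1) p} → Definable structure X →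
                 (∀ n → ∃ λ x → n ≤ f x × X (x ∷ [])) →
                 ∃ λ n → ∀ x → n ≤ f x → X (x ∷ [])
    eventually (φ , φ⇔) unbounded with minimal φ
    ... | inj₁ (xs , ∈xs)
      with b , <b ← bounded-on f xs
      with x , b≤fx , Xx ← unbounded b =
      contradiction b≤fx (<⇒≱ (<b (∈xs x (from (φ⇔ (x ∷ [])) Xx))))
    ... | inj₂ (xs , ∈xs) with b , <b ← bounded-on f xs =
      b , λ x b≤fx → to (φ⇔ (x ∷ []))
        (em⇒dne em λ ¬sat → <⇒≱ (<b (∈xs x ¬sat)) b≤fx)

    ascents-unbounded : ∀ a n → ∃ λ z → n ≤ f z × f z ≤ f (z + a)
    ascents-unbounded a n = em⇒dne em λ none →
      let
        b , <b   = bounded-on-initialSegment (λ y → f (y + a)) n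
        -- Rank at least `b` is needed for elements of rank at most `n`, whose translates have rank
        -- below `b`; all others descend by `none`. So translation by `a` sends the segment up to
        -- `f z` to ranks strictly below `f z`.
        z , fz≡  = f-surj (n ⊔ b)
        xs , ∈xs = initialSegment-finite (f z)

        drop : ∀ x → f x ≤ f z → f (x + a) < f z
        drop x fx≤fz = [ (λ n≤fx → <-≤-trans (≰⇒> λ le → none (x , n≤fx , le)) fx≤fz)
                       , (λ fx≤n → <-≤-trans (<b x fx≤n)
                                     (≤-trans (m≤n⊔m n b) (≤-reflexive (sym fz≡))))
                       ]′ (≤-total n (f x))

        -- The orbit of `z` stays in the finite segment and returns to `z`, yet every translate has
        -- smaller rank than `z`.
        k , return = recurrent (∙-cancelʳ a _ _) z xs (λ k → ∈xs _ (orbit≤ drop k))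
      in <-irrefl (cong f return) (drop _ (orbit≤ drop k))
      where
      orbit≤ : ∀ {z} → (∀ x → f x ≤ f z → f (x + a) < f z) → ∀ k → f (fold z (_+ a) k) ≤ f z
      orbit≤ drop zero    = ≤-refl
      orbit≤ drop (suc k) = <⇒≤ (drop _ (orbit≤ drop k))

    -- The filtration by subgroups

    NondecreasingFrom : ℕ → Pred Carrier ℓ
    NondecreasingFrom n a = ∀ z → n ≤ f z → f z ≤ f (z + a)

    -- The condition on `a` alone gives closure under addition; imposing it on `- a` as well gives
    -- closure under subtraction.
    S : ℕ → Pred Carrier ℓ
    S n a = NondecreasingFrom n a × NondecreasingFrom n (- a)

    -- Translation by `a` keeps the rank at least `n`, so the condition on `b` applies at `z + a`.
    nondecreasing-+ : ∀ {n a b} → NondecreasingFrom n a → NondecreasingFrom n b →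
                      NondecreasingFrom n (a + b)
    nondecreasing-+ {a = a} {b} ha hb z n≤fz =
      ≤-trans z≤z+a (subst (λ w → f (z + a) ≤ f w) (assoc z a b) (hb (z + a) (≤-trans n≤fz z≤z+a)))
      where z≤z+a = ha z n≤fz

    S-minus : ∀ {n a b} → S n a → S n b → S n (a - b)
    S-minus {n} {a} {b} (a↑ , -a↑) (b↑ , -b↑) =
      nondecreasing-+ a↑ -b↑ ,
      subst (NondecreasingFrom n) (sym (⁻¹-anti-homo‿- a b)) (nondecreasing-+ b↑ -a↑)

    S-mono : ∀ {m n a} → m ≤ n → S m a → S n a
    S-mono m≤n (a↑ , -a↑) =
      (λ z n≤fz → a↑ z (≤-trans m≤n n≤fz)) , (λ z n≤fz → -a↑ z (≤-trans m≤n n≤fz))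

    eventually-nondecreasing : ∀ a → ∃ λ n → NondecreasingFrom n a
    eventually-nondecreasing a =
      eventually (≤̇-def (var 0F) (var 0F +̇ par a)) (ascents-unbounded a)

    S-exhausts : ∀ a → ∃ λ n → S n a
    S-exhausts a with m , a↑ ← eventually-nondecreasing a | n , -a↑ ← eventually-nondecreasing (- a) =
      m ⊔ n , (λ z le → a↑ z (≤-trans (m≤m⊔n m n) le)) , (λ z le → -a↑ z (≤-trans (m≤n⊔m m n) le))

    -- The segment is finite, so the stages at which its elements appear have a common bound.
    S-contains-initialSegment : ∀ n → ∃ λ m → ∀ x → f x ≤ n → S m x
    S-contains-initialSegment n =
      let m , <m = bounded-on-initialSegment (proj₁ ∘ S-exhausts) n
      in m , λ x fx≤n → S-mono (<⇒≤ (<m x fx≤n)) (proj₂ (S-exhausts x))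

    -- Translation by `w - z` takes `z`, of rank `n + 1`, down to `w`, of rank `n`.
    S-proper : ∀ n → ∃ λ a → ¬ S n a
    S-proper n with z , fz≡ ← f-surj (suc n) | w , fw≡n ← f-surj n =
      w - z , λ (w-z↑ , _) → <⇒≱ (≤-reflexive (sym fz≡)) (begin
        f z             ≤⟨ w-z↑ z (≤-trans (n≤1+n n) (≤-reflexive (sym fz≡))) ⟩
        f (z + (w - z)) ≡⟨ cong f (trans (comm z (w - z)) (//-rightDividesˡ z w)) ⟩
        f w             ≡⟨ fw≡n ⟩
        n               ∎)
      where open ≤-Reasoning

    -- Comparison of the filtration with the order

    infix 4 _⊏_

    -- `a` enters the filtration strictly before `b`. Stages are named by elements `c` through their
    -- ranks, so that the quantifier over stages is first-order; surjectivity of `f` ensures that no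
    -- stage is lost.
    _⊏_ : Rel Carrier ℓ
    a ⊏ b = ∃ λ c → S (f c) a × ¬ S (f c) b

    ⊏-intro : ∀ n {a b} → S n a → ¬ S n b → a ⊏ b
    ⊏-intro n Sa ¬Sb with c , refl ← f-surj n = c , Sa , ¬Sb

    S-def : Definable structure {n = 2} (λ xs → S (f (lookup xs 0F)) (lookup xs 1F))
    S-def = definable-× structure nondecreasing-def
                        (definable-∘ structure nondecreasing-def (var 0F ∷ -̇ var 1F ∷ []))
      where
      nondecreasing-def : Definable structure {n = 2}
                            (λ xs → NondecreasingFrom (f (lookup xs 0F)) (lookup xs 1F))
      nondecreasing-def = definable-∀ structure
        (definable-→ structure (≤̇-def (var 1F) (var 0F)) (≤̇-def (var 0F) (var 0F +̇ var 2F)))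

    ⊏-def : Definable structure {n = 2} (λ xs → lookup xs 0F ⊏ lookup xs 1F)
    ⊏-def = definable-∃ structure
      (definable-× structure
        (definable-∘ structure S-def (var 0F ∷ var 1F ∷ []))
        (definable-¬ structure (definable-∘ structure S-def (var 0F ∷ var 2F ∷ []))))

    <-def : Definable structure {n = 2} (λ xs → f (lookup xs 0F) < f (lookup xs 1F))
    <-def = definable-resp-⇔ structure (λ _ → mk⇔ ≰⇒> <⇒≱)
      (definable-¬ structure (≤̇-def (var 1F) (var 0F)))

    -- The element of least rank outside S b works, as soon as S b contains
    -- all elements of rank at most n.

    eventually-<⇒⊏ : ∃ λ n → ∀ x → n ≤ f x → ∀ y → f y < f x → y ⊏ x
    eventually-<⇒⊏ = eventually
      (definable-∀ structure (definable-→ structure <-def ⊏-def)) unbounded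
      where
      unbounded : ∀ n → ∃ λ x → n ≤ f x × (∀ y → f y < f x → y ⊏ x)
      unbounded n =
        let b , segment⊆S    = S-contains-initialSegment n
            x , ¬Sx , least = minimal-element em f (¬_ ∘ S b) (S-proper b)
        in x , <⇒≤ (≰⇒> (¬Sx ∘ segment⊆S x)) ,
           λ y fy<fx → ⊏-intro b (em⇒dne em (least y fy<fx)) ¬Sx

    -- An element which among those of rank at least n is in S m for the
    -- least possible m works.

    eventually-⊏⇒< : ∃ λ n → ∀ x → n ≤ f x → ∀ y → y ⊏ x → f y < f x
    eventually-⊏⇒< = eventually
      (definable-∀ structure (definable-→ structure ⊏-def <-def)) unbounded
      where
      unbounded : ∀ n → ∃ λ x → n ≤ f x × (∀ y → y ⊏ x → f y < f x)
      unbounded n =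
        let u , fu≡n = f-surj n
            k , Sku  = S-exhausts u
            e , fe≡k = f-surj k
            c , (x , n≤fx , Sx) , least =
              minimal-element em f (λ c → ∃ λ x → n ≤ f x × S (f c) x)
                (e , u , ≤-reflexive (sym fu≡n) , subst (λ i → S i u) (sym fe≡k) Sku)
        in x , n≤fx , λ y (d , Sy , ¬Sx) → <-≤-trans
             (≰⇒> λ n≤fy → least d (≰⇒> λ c≤d → ¬Sx (S-mono c≤d Sx)) (y , n≤fy , Sy)) n≤fx

    -- The later of the two given stages contains both `x` and `y` and still misses `z`.
    ⊏-minus : ∀ {x y z} → x ⊏ z → y ⊏ z → x - y ⊏ z
    ⊏-minus (c , Sx , ¬Scz) (d , Sy , ¬Sdz) =
      [ (λ c≤d → d , S-minus (S-mono c≤d Sx) Sy , ¬Sdz)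
      , (λ d≤c → c , S-minus Sx (S-mono d≤c Sy) , ¬Scz)
      ]′ (≤-total (f c) (f d))

    -- For large `m` and `z` of rank `m + 1`, the elements of rank at most `m` are exactly those
    -- that precede `z` in the filtration, and these are closed under subtraction.
    eventually-subgroup : ∃ λ n → ∀ m → n ≤ m → ∀ x y → f x ≤ m → f y ≤ m → f (x - y) ≤ m
    eventually-subgroup =
      let n₁ , <⇒⊏ = eventually-<⇒⊏
          n₂ , ⊏⇒< = eventually-⊏⇒<
      in n₁ ⊔ n₂ , λ m n≤m x y fx≤m fy≤m →
        let z , fz≡1+m = f-surj (suc m)
            n≤fz       = ≤-trans (m≤n⇒m≤1+n n≤m) (≤-reflexive (sym fz≡1+m))
            n₁≤fz      = ≤-trans (m≤m⊔n n₁ n₂) n≤fz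
            n₂≤fz      = ≤-trans (m≤n⊔m n₁ n₂) n≤fz
            ≤m⇒⊏z      = λ w fw≤m → <⇒⊏ z n₁≤fz w (subst (f w <_) (sym fz≡1+m) (s≤s fw≤m))
        in ≤-pred (subst (f (x - y) <_) fz≡1+m
             (⊏⇒< z n₂≤fz (x - y) (⊏-minus (≤m⇒⊏z x fx≤m) (≤m⇒⊏z y fy≤m))))

  -- Collapsing a large initial segment

  module Collapse
    (f : Carrier → ℕ) (f-surj : ∀ n → ∃ λ x → f x ≡ n)
    (M : ℕ) (f0≤M : f 0# ≤ M) (d : Carrier) (d≢0 : d ≢ 0#) (fd≤M : f d ≤ M)
    where

    -- The truncated subtraction sends all nonzero elements with f x ≤ M to 1.

    g : Carrier → ℕ
    g x with em {x ≡ 0#}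
    ... | yes _ = 0
    ... | no  _ = suc (f x ∸ M)

    g-zero : g 0# ≡ 0
    g-zero with em {0# ≡ 0#}
    ... | yes _  = refl
    ... | no 0≢0 = contradiction refl 0≢0

    g-nonzero : ∀ {x} → x ≢ 0# → g x ≡ suc (f x ∸ M)
    g-nonzero {x} x≢0 with em {x ≡ 0#}
    ... | yes x≡0 = contradiction x≡0 x≢0
    ... | no  _   = refl

    g≡0⇒≡0 : ∀ {x} → g x ≡ 0 → x ≡ 0#
    g≡0⇒≡0 {x} gx≡0 with em {x ≡ 0#}
    ... | yes x≡0 = x≡0

    -- Apart from the segment of 0 alone, the initial segments of `g` are those of `f` from `M` on,
    -- so closure under subtraction carries over.
    g≤1+⇔ : ∀ {x j} → g x ≤ suc j ⇔ f x ≤ M ℕ.+ j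
    g≤1+⇔ {x} {j} with em {x ≡ 0#}
    ... | yes refl = mk⇔ (λ _ → ≤-trans f0≤M (m≤m+n M j)) (λ _ → z≤n)
    ... | no  _    = mk⇔
      (λ { (s≤s le) → ≤-trans (m≤n+m∸n (f x) M) (+-monoʳ-≤ M le) })
      (λ le → s≤s (m≤n+o⇒m∸n≤o (f x) M le))

    g≤1 : ∀ {x} → f x ≤ M → g x ≤ 1
    g≤1 le = from g≤1+⇔ (≤-trans le (m≤m+n M 0))

    f≰M⇒≢0 : ∀ {x} → M < f x → x ≢ 0#
    f≰M⇒≢0 M<fx refl = <⇒≱ M<fx f0≤M

    g>1 : ∀ {x} → M < f x → 1 < g x
    g>1 M<fx = subst (1 <_) (sym (g-nonzero (f≰M⇒≢0 M<fx))) (s≤s (m<n⇒0<n∸m M<fx))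

    g-surj : ∀ n → ∃ λ x → g x ≡ n
    g-surj zero          = 0# , g-zero
    -- The nonzero element `d` of the collapsed segment keeps rank 1 from being skipped.
    g-surj (suc zero)    = d , trans (g-nonzero d≢0) (cong suc (m≤n⇒m∸n≡0 fd≤M))
    g-surj (suc (suc n)) with x , fx≡ ← f-surj (M ℕ.+ suc n) =
      x , trans (g-nonzero (f≰M⇒≢0 (subst (M <_) (sym fx≡) (m<m+n M z<s))))
                (cong suc (trans (cong (_∸ M) fx≡) (m+n∸m≡n M (suc n))))

    -- Above `M` the rank is merely shifted, and elements on different sides of `M` have `g` at most
    -- 1 and greater than 1. Hence only pairs inside the collapsed segment can change.
    <⇔g< : ∀ {x y} → ¬ (f x ≤ M × f y ≤ M) → f x < f y ⇔ g x < g y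
    <⇔g< {x} {y} not-both with ≤-<-connex (f x) M | ≤-<-connex (f y) M
    ... | inj₁ x≤M | inj₁ y≤M = contradiction (x≤M , y≤M) not-both
    ... | inj₁ x≤M | inj₂ M<y =
      mk⇔ (λ _ → ≤-<-trans (g≤1 x≤M) (g>1 M<y)) (λ _ → ≤-<-trans x≤M M<y)
    ... | inj₂ M<x | inj₁ y≤M =
      mk⇔ (λ lt → contradiction (≤-trans y≤M (<⇒≤ M<x)) (<⇒≱ lt))
          (λ lt → contradiction (≤-trans (g≤1 y≤M) (<⇒≤ (g>1 M<x))) (<⇒≱ lt))
    ... | inj₂ M<x | inj₂ M<y
      rewrite g-nonzero (f≰M⇒≢0 M<x) | g-nonzero (f≰M⇒≢0 M<y) =
      mk⇔ (λ lt → s<s (∸-monoˡ-< lt (<⇒≤ M<x)))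
          (λ { (s<s lt) → ≰⇒> λ y≤x → <⇒≱ lt (∸-monoˡ-≤ M y≤x) })

    open RankOrder g g-surj

    collapse-isValuation :
      (∀ m → M ≤ m → ∀ x y → f x ≤ m → f y ≤ m → f (x - y) ≤ m) →
      IsValuation G (quotientOrder _≺_ valueLeq-isTotalOrder) (quotientMap _≺_ valueLeq-isTotalOrder)
    collapse-isValuation closed = record
      { surjective  = λ x → x , λ { refl → IsEquivalence.refl ∼-isEquivalence }
      ; ∞           = 0#
      ; maximum     = λ x → from valueLeq⇔ (subst (_≤ g x) (sym g-zero) z≤n)
      ; v≈∞⇔≡0      = λ x → mk⇔ (λ x∼0 → g≡0⇒≡0 (trans (to incomparable⇔ x∼0) g-zero))
                                 (λ { refl → IsEquivalence.refl ∼-isEquivalence })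
      -- The value order reverses ranks, so the minimum of `x` and `y` has the larger rank and
      -- bounds both.
      ; ultrametric = λ x y → from valueLeq⇔
          (g-minus (g (x ⊓ y)) (to valueLeq⇔ (x⊓y≤x x y)) (to valueLeq⇔ (x⊓y≤y x y)))
      }
      where
      open Min (quotientOrder _≺_ valueLeq-isTotalOrder) using (_⊓_; x⊓y≤x; x⊓y≤y)

      g-minus : ∀ n {x y} → g x ≤ n → g y ≤ n → g (x - y) ≤ n
      -- Rank 0 belongs to 0 alone; every larger bound reduces to a segment of `f` to which `closed`
      -- applies.
      g-minus zero gx≤0 gy≤0
        rewrite g≡0⇒≡0 (n≤0⇒n≡0 gx≤0) | g≡0⇒≡0 (n≤0⇒n≡0 gy≤0) | inverseʳ 0# = ≤-reflexive g-zero
      g-minus (suc j) gx≤ gy≤ =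
        from g≤1+⇔ (closed (M ℕ.+ j) (m≤m+n M j) _ _ (to g≤1+⇔ gx≤) (to g≤1+⇔ gy≤))

-- The modified order and interdefinability

proposition4p1 : ∀ {ℓ} → ExcludedMiddle ℓ →
    ∀ {L : Signature ℓ} (G : ExpandedGroup L) → let open ExpandedGroup G in
    IsMinimal structure →
    AlmostLinear structure →
    ∀ (_<_ : Rel Carrier ℓ) →
    IsStrictPartialOrder _≡_ _<_ →
    Definable₂ structure _<_ →
    IsEquivalence (Incomparable _<_) →
    HasQuotientOfTypeω _<_ →
    ∃ λ (_<′_ : Rel Carrier ℓ) →
    IsStrictPartialOrder _≡_ _<′_ ×
    Definable₂ structure _<′_ ×
    AgreeOffFiniteSet _<_ _<′_ ×
    IsEquivalence (Incomparable _<′_) ×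
    Σ (IsTotalOrder (Incomparable _<′_) (ValueLeq _<′_)) (λ isTotalOrder →
    IsValuation G (quotientOrder _<′_ isTotalOrder) (quotientMap _<′_ isTotalOrder)) ×
    HasValueOrderOfTypeω* _<′_ ×
    Interdefinable _<′_ (ValueLeq _<′_) ×
    Interdefinable _<_ (ValueLeq _<′_)
proposition4p1 {ℓ} em G G-minimal _ _<_ _ <-def _ (f , f-iso) =
  _≺_ , ≺-isStrictPartialOrder , definable-≺ <-def , (B , agree) ,
  ∼-isEquivalence , (valueLeq-isTotalOrder , collapse-isValuation closed) ,
  hasValueOrderOfTypeω* ,
  (≺-from-value , definable-value (relation-definable _≺_)) ,
  (definable-< ≺-from-value , definable-value (definable-≺ (relation-definable _<_)))
  where
  open ExpandedGroup G
  open IsOrderIsomorphism f-iso using (mono; cancel; surjective)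

  f-surj : ∀ n → ∃ λ x → f x ≡ n
  f-surj n =
    let x , fx≡n = surjective n
    -- Surjectivity speaks about all elements incomparable to `x`; `x` is one of them, since `mono`
    -- would turn `x < x` into a strict inequality of a number with itself.
    in x , fx≡n [ (λ x<x → n≮n (f x) (mono x<x)) , (λ x<x → n≮n (f x) (mono x<x)) ]′

  ≤-def : Definable structure {n = 2} (λ xs → f (lookup xs 0F) ≤ f (lookup xs 1F))
  ≤-def = definable-resp-⇔ structure
    (λ _ → mk⇔ (λ y≮x → ≮⇒≥ (y≮x ∘ cancel)) (λ x≤y → ≤⇒≯ x≤y ∘ mono))
    (definable-¬ structure
      (definable-∘ structure (definable₂⇒definable structure <-def) (var 1F ∷ var 0F ∷ [])))

  open InitialSegments em G G-minimal f f-surj ≤-def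
    using (initialSegment-finite; eventually-subgroup)

  N : ℕ
  N = proj₁ eventually-subgroup

  above-0 : ∃ λ d → f d ≡ suc (f 0#)
  above-0 = f-surj (suc (f 0#))

  d : Carrier
  d = proj₁ above-0

  fd≡ : f d ≡ suc (f 0#)
  fd≡ = proj₂ above-0

  -- At least `N` for closure under subtraction, and at least `f d` so that both `d` and 0, whose
  -- rank is one less, lie in the collapsed segment.
  M : ℕ
  M = N ⊔ f d

  fd≤M : f d ≤ M
  fd≤M = m≤n⊔m N (f d)

  open Collapse em G f f-surj M
    (≤-trans (n≤1+n _) (≤-trans (≤-reflexive (sym fd≡)) fd≤M))
    d (λ d≡0 → 1+n≢n (trans (sym fd≡) (cong f d≡0))) fd≤M
  open RankOrder g g-surj

  closed : ∀ m → M ≤ m → ∀ x y → f x ≤ m → f y ≤ m → f (x + (- y)) ≤ m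
  closed m M≤m = proj₂ eventually-subgroup m (≤-trans (m≤m⊔n N (f d)) M≤m)

  <⇔≺ : ∀ {x y} → ¬ (f x ≤ M × f y ≤ M) → (x < y) ⇔ (x ≺ y)
  <⇔≺ h = mk⇔ (lift ∘ to (<⇔g< h) ∘ mono) (cancel ∘ from (<⇔g< h) ∘ lower)

  B : List Carrier
  B = proj₁ (initialSegment-finite M)

  ∈B : ∀ x → f x ≤ M → x ∈ B
  ∈B = proj₂ (initialSegment-finite M)

  agree : ∀ x y → x ∉ B → y ∉ B → (x ≺ y) ⇔ (x < y)
  agree x y x∉B _ = ⇔-sym (<⇔≺ (λ (fx≤M , _) → x∉B (∈B x fx≤M)))

  ∉B² : ∀ {x y} → (x , y) ∉ cartesianProduct B B → ¬ (f x ≤ M × f y ≤ M)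
  ∉B² xy∉ (fx≤M , fy≤M) = xy∉ (∈-cartesianProduct⁺ (∈B _ fx≤M) (∈B _ fy≤M))

  -- The two orders differ at most on pairs with both entries in `B`, so there are finitely many
  -- pairs to correct. The interpretation is arbitrary because this serves both the given structure
  -- and the group with `<` alone.
  definable-≺ : ∀ {L′} {I : Interpretation L′ Carrier} →
                Definable₂ (expandBy I) _<_ → Definable₂ (expandBy I) _≺_
  definable-≺ = definable₂-modulo-finite _ em (cartesianProduct B B) λ _ _ xy∉ → <⇔≺ (∉B² xy∉)

  definable-< : ∀ {L′} {I : Interpretation L′ Carrier} →
                Definable₂ (expandBy I) _≺_ → Definable₂ (expandBy I) _<_
  definable-< =
    definable₂-modulo-finite _ em (cartesianProduct B B) λ _ _ xy∉ → ⇔-sym (<⇔≺ (∉B² xy∉))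

  definable-value : ∀ {L′} {I : Interpretation L′ Carrier} →
                    Definable₂ (expandBy I) _≺_ → Definable₂ (expandBy I) (ValueLeq _≺_)
  definable-value {I = I} ≺-def = definable⇒definable₂ (expandBy I)
    (definable-resp-⇔ (expandBy I) (λ xs → ≮⇔valueLeq (lookup xs 0F) (lookup xs 1F))
      (definable-¬ (expandBy I) (definable₂⇒definable (expandBy I) ≺-def)))

  relation-definable : ∀ R′ → Definable₂ (groupWith R′) R′
  relation-definable R′ = rel R (var 0F ∷ var 1F ∷ []) , λ _ _ → ⇔-id _

  ≺-from-value : Definable₂ (groupWith (ValueLeq _≺_)) _≺_
  ≺-from-value = definable⇒definable₂ K
    (definable-resp-⇔ K (λ xs → ¬valueLeq⇔≺ (lookup xs 0F) (lookup xs 1F))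
      (definable-¬ K (definable₂⇒definable K (relation-definable (ValueLeq _≺_)))))
    where K = groupWith (ValueLeq _≺_)
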